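{- Let $P\subset\mathbb{R}^2$ be a finite point set of size $n$ satisfying the standing condition, let $X\subseteq P$ be its set of extreme points (given as input), and let $\varepsilon\in(0,1)$. The algorithm E-GRMR described in the context runs in $O(n^3)$ time.
   Context: For finite $Q \subset \mathbb{R}^2$ and unit $x$, $\omega(x,Q)=\max_{p\in Q}\langle p,x\rangle$. Standing condition: $\omega(x,P)>0$ for all $x\in\mathbb{S}^1$. Extreme points $X=\{t_1,\dots,t_m\}$ are the vertices of the convex hull of $P$ (the points that are top-ranked, $\langle p,x\rangle = \omega(x,P)$, for some nonzero $x$), indexed counterclockwise by polar angle, cyclically. Algorithm E-GRMR on input $(P,X,\varepsilon)$: (1) For each $i$, compute the unit vector $x^*_i$ with $\langle t_i,x\rangle=\langle t_{i+1},x\rangle$, $\langle t_i,x\rangle>0$; set $S=X$ and add to $S$ each $p\in P\setminus X$ for which some $i$ has $\langle p,x^*_i\rangle\ge(1-\varepsilon)\langle t_i,x^*_i\rangle$; index $S$ as $s_1,\dots,s_{|S|}$ counterclockwise by polar angle. (2) Build a directed graph $G$ on vertex set $S$: for each ordered pair $i\neq j$, skip if the counterclockwise angle from $s_i$ to $s_j$ is at least $\pi$; otherwise compute $l_{ij}=\max_{t\in X[s_i,s_j]}(1-\langle s_i,x^*\rangle/\langle t,x^*\rangle)$ (taken as $0$ if $X[s_i,s_j]$ is empty), where $X[s_i,s_j]$ is the set of extreme points with polar angle in the counterclockwise range from $s_i$ to $s_j$ inclusive and $x^*$ is the unit vector with $\langle s_i,x^*\rangle=\langle s_j,x^*\rangle$,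 $\langle s_i,x^*\rangle\ge0$; add edge $s_i\to s_j$ if $l_{ij}\le\varepsilon$. (3) Find a shortest directed cycle $C^*$ of $G$ by running Dijkstra's algorithm from each vertex, and return its vertex set. -}

module Defs where

open import Algebra.Core using (Op₁; Op₂)
open import Algebra.Structures using (IsCommutativeRing)
open import Data.Bool.Base using (Bool; true; false; not; _∧_; _∨_; if_then_else_)
open import Data.Fin.Base using (Fin; zero; suc; fromℕ<)
open import Data.Fin.Subset using (Subset; _∈_)
open import Data.Nat.Base as ℕ using (ℕ; zero; suc; NonZero)
import Data.Nat.Properties as ℕ
open import Data.Product.Base using (_×_; _,_; proj₁; proj₂; ∃; ∃-syntax)
open import Data.Vec.Base using (lookup)
open import Function.Base using (_∘_)
open import Function.Bundles using (_⇔_)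
open import Relation.Binary.Core using (Rel)
open import Relation.Binary.PropositionalEquality using (_≡_; _≢_)
open import Relation.Binary.Structures using (IsDecTotalOrder)
import Relation.Binary.Construct.NonStrictToStrict as NonStrictToStrict
open import Relation.Nullary using (does; yes; no)

------------------------------------------------------------------------
-- The real numbers: a Dedekind-complete ordered field. The order is
-- decidable because the real RAM compares reals in one step. The values
-- of _⁻¹ at 0 and of sqrt at negative numbers are left unspecified.

record Reals : Set₁ where
  infix  9 _⁻¹
  infix  8 -_
  infixl 7 _*_
  infixl 6 _+_ _-_
  infix  4 _≤_
  field
    ℝ                 : Set
    _+_ _*_           : Op₂ ℝ
    -_ _⁻¹ sqrt       : Op₁ ℝ
    0ℝ 1ℝ             : ℝ
    _≤_               : ℝ → ℝ → Set
    isCommutativeRing : IsCommutativeRing _≡_ _+_ _*_ -_ 0ℝ 1ℝ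
    isDecTotalOrder   : IsDecTotalOrder _≡_ _≤_
    0≢1               : 0ℝ ≢ 1ℝ
    ⁻¹-inverse        : ∀ x → x ≢ 0ℝ → x * x ⁻¹ ≡ 1ℝ
    +-monoˡ-≤         : ∀ z {x y} → x ≤ y → (x + z) ≤ (y + z)
    *-nonNeg          : ∀ {x y} → 0ℝ ≤ x → 0ℝ ≤ y → 0ℝ ≤ (x * y)
    sqrt-nonNeg       : ∀ {x} → 0ℝ ≤ x → 0ℝ ≤ sqrt x
    sqrt-square       : ∀ {x} → 0ℝ ≤ x → sqrt x * sqrt x ≡ x
    complete          : (A : ℝ → Set) → ∃ A →
                        (∃[ b ] (∀ a → A a → a ≤ b)) →
                        ∃[ s ] ((∀ a → A a → a ≤ s) ×
                                (∀ b → (∀ a → A a → a ≤ b) → s ≤ b))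

  open IsDecTotalOrder isDecTotalOrder public using (_≤?_)
  open NonStrictToStrict _≡_ _≤_ public using (_<_)

  _-_ : Op₂ ℝ
  x - y = x + (- y)

  _⊔_ : Op₂ ℝ
  x ⊔ y = if does (x ≤? y) then y else x

------------------------------------------------------------------------

module Plane (R : Reals) where
  open Reals R

  Point : Set
  Point = ℝ × ℝ

  ⟨_,_⟩ : Point → Point → ℝ
  ⟨ (a , b) , (c , d) ⟩ = a * c + b * d

  Unit : Point → Set
  Unit x = ⟨ x , x ⟩ ≡ 1ℝ

  ω : ∀ {n} .{{_ : NonZero n}} → Point → (Fin n → Point) → ℝ
  ω {suc zero}    x Q = ⟨ Q zero , x ⟩
  ω {suc (suc _)} x Q = ⟨ Q zero , x ⟩ ⊔ ω x (Q ∘ suc)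

  StandingCondition : ∀ {n} .{{_ : NonZero n}} → (Fin n → Point) → Set
  StandingCondition P = ∀ x → Unit x → 0ℝ < ω x P

  Extreme : ∀ {n} .{{_ : NonZero n}} → (Fin n → Point) → Fin n → Set
  Extreme P i = ∃[ x ] (x ≢ (0ℝ , 0ℝ) × ⟨ P i , x ⟩ ≡ ω x P)

  IsExtremeSet : ∀ {n} .{{_ : NonZero n}} → (Fin n → Point) → Subset n → Set
  IsExtremeSet P X = ∀ i → (i ∈ X) ⇔ Extreme P i

------------------------------------------------------------------------
-- Programs of a structured real RAM, with variables and unbounded arrays
-- of naturals (used as indices and counters), reals and booleans.

data Ty : Set where
  nat real bool : Ty

record Var (τ : Ty) : Set where
  constructor mkVar
  field name : ℕ

record Arr (τ : Ty) : Set where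
  constructor mkArr
  field name : ℕ

infix  11 _[_]
infixl 9 _*ᴺ_ _*ᴿ_ _/ᴿ_
infixl 8 _+ᴺ_ _∸ᴺ_ _+ᴿ_ _-ᴿ_
infix  7 _<ᴺ_ _≡ᴺ_ _≤ᴿ_
infixr 6 _andᴮ_
infixr 5 _orᴮ_

data Exp : Ty → Set where
  litᴺ                : ℕ → Exp nat
  litᴮ                : Bool → Exp bool
  0ᴿ 1ᴿ               : Exp real
  ` : ∀ {τ}           → Var τ → Exp τ
  _[_] : ∀ {τ}        → Arr τ → Exp nat → Exp τ
  _+ᴺ_ _∸ᴺ_ _*ᴺ_      : Exp nat → Exp nat → Exp nat
  _+ᴿ_ _-ᴿ_ _*ᴿ_ _/ᴿ_ : Exp real → Exp real → Exp real
  √ᴿ                  : Exp real → Exp real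
  _<ᴺ_ _≡ᴺ_           : Exp nat → Exp nat → Exp bool
  _≤ᴿ_                : Exp real → Exp real → Exp bool
  notᴮ                : Exp bool → Exp bool
  _andᴮ_ _orᴮ_        : Exp bool → Exp bool → Exp bool

infix  4 _:=_ _[_]:=_
infix  3 when_▹_ if_then_else′_ for_below_▹_
infixr 2 _⨾_

data Cmd : Set where
  skip            : Cmd
  _:=_ : ∀ {τ}    → Var τ → Exp τ → Cmd
  _[_]:=_ : ∀ {τ} → Arr τ → Exp nat → Exp τ → Cmd
  _⨾_             : Cmd → Cmd → Cmd
  if_then_else′_  : Exp bool → Cmd → Cmd → Cmd
  -- the body is run with the variable set to 0, 1, …, e - 1 in turn,
  -- the bound e being evaluated once, on entry
  for_below_▹_   : Var nat → Exp nat → Cmd → Cmd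

when_▹_ : Exp bool → Cmd → Cmd
when b ▹ c = if b then c else′ skip

------------------------------------------------------------------------
-- Semantics and running time. Every operation, constant, memory access,
-- assignment, branch and loop test takes one time unit.

module Machine (R : Reals) where
  open Reals R

  Val : Ty → Set
  Val nat  = ℕ
  Val real = ℝ
  Val bool = Bool

  record State : Set where
    constructor mkState
    field
      vars : (τ : Ty) → ℕ → Val τ
      arrs : (τ : Ty) → ℕ → ℕ → Val τ
  open State public

  put : {A : Set} → ℕ → A → (ℕ → A) → (ℕ → A)
  put k a f l = if k ℕ.≡ᵇ l then a else f l

  update : {F : Ty → Set} (τ : Ty) → ((ℕ → F τ) → (ℕ → F τ)) →
           ((σ : Ty) → ℕ → F σ) → ((σ : Ty) → ℕ → F σ)
  update nat  g f nat  = g (f nat)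
  update real g f real = g (f real)
  update bool g f bool = g (f bool)
  update _    g f σ    = f σ

  setVar : ∀ {τ} → Var τ → Val τ → State → State
  setVar {τ} (mkVar x) v s =
    record s { vars = update {Val} τ (put x v) (vars s) }

  setArr : ∀ {τ} → Arr τ → ℕ → Val τ → State → State
  setArr {τ} (mkArr a) i v s =
    record s { arrs = update {λ σ → ℕ → Val σ} τ
                        (put a (put i v (arrs s τ a))) (arrs s) }

  eval : ∀ {τ} → Exp τ → State → Val τ
  eval (litᴺ k)               s = k
  eval (litᴮ b)               s = b
  eval 0ᴿ                     s = 0ℝ
  eval 1ᴿ                     s = 1ℝ
  eval (` {τ} (mkVar x))      s = vars s τ x
  eval (_[_] {τ} (mkArr a) e) s = arrs s τ a (eval e s)
  eval (e +ᴺ f)               s = eval e s ℕ.+ eval f s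
  eval (e ∸ᴺ f)               s = eval e s ℕ.∸ eval f s
  eval (e *ᴺ f)               s = eval e s ℕ.* eval f s
  eval (e +ᴿ f)               s = eval e s + eval f s
  eval (e -ᴿ f)               s = eval e s - eval f s
  eval (e *ᴿ f)               s = eval e s * eval f s
  eval (e /ᴿ f)               s = eval e s * eval f s ⁻¹
  eval (√ᴿ e)                 s = sqrt (eval e s)
  eval (e <ᴺ f)               s = eval e s ℕ.<ᵇ eval f s
  eval (e ≡ᴺ f)               s = eval e s ℕ.≡ᵇ eval f s
  eval (e ≤ᴿ f)               s = does (eval e s ≤? eval f s)
  eval (notᴮ e)               s = not (eval e s)
  eval (e andᴮ f)             s = eval e s ∧ eval f s
  eval (e orᴮ f)              s = eval e s ∨ eval f s

  expTime : ∀ {τ} → Exp τ → ℕ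
  expTime (litᴺ _)   = 1
  expTime (litᴮ _)   = 1
  expTime 0ᴿ         = 1
  expTime 1ᴿ         = 1
  expTime (` _)      = 1
  expTime (_ [ e ])  = 1 ℕ.+ expTime e
  expTime (e +ᴺ f)   = 1 ℕ.+ expTime e ℕ.+ expTime f
  expTime (e ∸ᴺ f)   = 1 ℕ.+ expTime e ℕ.+ expTime f
  expTime (e *ᴺ f)   = 1 ℕ.+ expTime e ℕ.+ expTime f
  expTime (e +ᴿ f)   = 1 ℕ.+ expTime e ℕ.+ expTime f
  expTime (e -ᴿ f)   = 1 ℕ.+ expTime e ℕ.+ expTime f
  expTime (e *ᴿ f)   = 1 ℕ.+ expTime e ℕ.+ expTime f
  expTime (e /ᴿ f)   = 1 ℕ.+ expTime e ℕ.+ expTime f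
  expTime (√ᴿ e)     = 1 ℕ.+ expTime e
  expTime (e <ᴺ f)   = 1 ℕ.+ expTime e ℕ.+ expTime f
  expTime (e ≡ᴺ f)   = 1 ℕ.+ expTime e ℕ.+ expTime f
  expTime (e ≤ᴿ f)   = 1 ℕ.+ expTime e ℕ.+ expTime f
  expTime (notᴮ e)   = 1 ℕ.+ expTime e
  expTime (e andᴮ f) = 1 ℕ.+ expTime e ℕ.+ expTime f
  expTime (e orᴮ f)  = 1 ℕ.+ expTime e ℕ.+ expTime f

  Run : Set
  Run = State → State × ℕ

  _then_ : Run → Run → Run
  (f then g) s = let (s₁ , t₁) = f s
                     (s₂ , t₂) = g s₁
                 in s₂ , t₁ ℕ.+ t₂

  spend : ℕ → Run
  spend t s = s , t

  repeat : (ℕ → Run) → ℕ → Run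
  repeat f zero    = spend 1
  repeat f (suc k) = repeat f k then (f k then spend 1)

  exec : Cmd → Run
  exec skip                   s = s , 1
  exec (x := e)               s = setVar x (eval e s) s , 1 ℕ.+ expTime e
  exec (a [ i ]:= e)          s = setArr a (eval i s) (eval e s) s ,
                                  1 ℕ.+ expTime i ℕ.+ expTime e
  exec (c ⨾ d)                s = (exec c then exec d) s
  exec (if b then c else′ d)  s =
    (spend (1 ℕ.+ expTime b) then (if eval b s then exec c else exec d)) s
  exec (for x below e ▹ c)   s =
    (spend (1 ℕ.+ expTime e) then
      repeat (λ k s′ → exec c (setVar x k s′)) (eval e s)) s

------------------------------------------------------------------------
-- The program E-GRMR. Its input is n, ε, the coordinates of the n points
-- of P and the membership vector of X; points are referred to by their
-- index in P. Its result is the membership vector C of the returned set.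

module Program where

  n m N i j p q r u v w src end bestDist bestLen inf : Var nat
  n        = mkVar 0
  m        = mkVar 1     -- |X|
  N        = mkVar 2     -- |S|
  i        = mkVar 3
  j        = mkVar 4
  p        = mkVar 5
  q        = mkVar 6
  r        = mkVar 7
  u        = mkVar 8
  v        = mkVar 9
  w        = mkVar 10
  src      = mkVar 11
  end      = mkVar 12
  bestDist = mkVar 13
  bestLen  = mkVar 14
  inf      = mkVar 15

  ε dx dy len x* y* l val : Var real
  ε   = mkVar 0
  dx  = mkVar 1
  dy  = mkVar 2
  len = mkVar 3
  x*  = mkVar 4
  y*  = mkVar 5
  l   = mkVar 6
  val = mkVar 7

  found improved : Var bool
  found    = mkVar 0
  improved = mkVar 1

  T S dist pred : Arr nat
  T    = mkArr 0         -- t₁, …, tₘ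
  S    = mkArr 1         -- s₁, …, s_N
  dist = mkArr 2
  pred = mkArr 3

  px py x*s y*s top : Arr real
  px  = mkArr 0
  py  = mkArr 1
  x*s = mkArr 2          -- (x*s [ i ] , y*s [ i ]) is x*ᵢ
  y*s = mkArr 3
  top = mkArr 4          -- ⟨ tᵢ , x*ᵢ ⟩

  inX inS adj done C : Arr bool
  inX  = mkArr 0
  inS  = mkArr 1
  adj  = mkArr 2         -- adj [ i * N + j ] : there is an edge sᵢ → sⱼ
  done = mkArr 3
  C    = mkArr 4

  infix 7 _<ᴿ_
  _<ᴿ_ : Exp real → Exp real → Exp bool
  e <ᴿ f = notᴮ (f ≤ᴿ e)

  dot cross : Exp nat → Exp nat → Exp real
  dot   a b = px [ a ] *ᴿ px [ b ] +ᴿ py [ a ] *ᴿ py [ b ]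
  cross a b = px [ a ] *ᴿ py [ b ] -ᴿ py [ a ] *ᴿ px [ b ]

  score : Exp nat → Exp real
  score a = px [ a ] *ᴿ ` x* +ᴿ py [ a ] *ᴿ ` y*

  -- For a point other than the origin: its polar angle is in [0, π).
  upper : Exp nat → Exp bool
  upper a = (0ᴿ <ᴿ py [ a ]) orᴮ (0ᴿ ≤ᴿ py [ a ]) andᴮ (0ᴿ ≤ᴿ px [ a ])

  -- The polar angle, taken in [0, 2π), of a is less than that of b.
  before : Exp nat → Exp nat → Exp bool
  before a b = (upper a andᴮ notᴮ (upper b))
               orᴮ ((upper a orᴮ notᴮ (upper b)) andᴮ (0ᴿ <ᴿ cross a b))

  -- The counterclockwise angle, taken in [0, 2π), from a to b is less than π.
  within-π : Exp nat → Exp nat → Exp bool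
  within-π a b = (0ᴿ <ᴿ cross a b)
                 orᴮ ((0ᴿ ≤ᴿ cross a b) andᴮ (0ᴿ ≤ᴿ dot a b))

  -- When within-π a b: t is in the counterclockwise range from a to b.
  inRange : Exp nat → Exp nat → Exp nat → Exp bool
  inRange a b t = within-π a t andᴮ (0ᴿ ≤ᴿ cross t b)

  sortByAngle : Arr nat → Var nat → Cmd
  sortByAngle A size =
    for u below ` size ▹
      for v below (` size ∸ᴺ litᴺ 1) ▹
        when before (A [ ` v +ᴺ litᴺ 1 ]) (A [ ` v ]) ▹
          ( w := A [ ` v ]
          ⨾ A [ ` v ]:= A [ ` v +ᴺ litᴺ 1 ]
          ⨾ A [ ` v +ᴺ litᴺ 1 ]:= ` w )

  -- The unit vector (x* , y*) with equal products with a and b, the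
  -- product being nonnegative.
  equalizer : Exp nat → Exp nat → Cmd
  equalizer a b =
      dx := px [ b ] -ᴿ px [ a ]
    ⨾ dy := py [ b ] -ᴿ py [ a ]
    ⨾ len := √ᴿ (` dx *ᴿ ` dx +ᴿ ` dy *ᴿ ` dy)
    ⨾ x* := ` dy /ᴿ ` len
    ⨾ y* := (0ᴿ -ᴿ ` dx) /ᴿ ` len
    ⨾ when score a <ᴿ 0ᴿ ▹
        ( x* := 0ᴿ -ᴿ ` x*
        ⨾ y* := 0ᴿ -ᴿ ` y* )

  collect : Arr bool → Arr nat → Var nat → Cmd
  collect marks A size =
      size := litᴺ 0
    ⨾ for p below ` n ▹
        when marks [ ` p ] ▹
          ( A [ ` size ]:= ` p
          ⨾ size := ` size +ᴺ litᴺ 1 )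

  indexX : Cmd
  indexX = collect inX T m ⨾ sortByAngle T m

  candidates : Cmd
  candidates =
      ( for i below ` m ▹
          ( p := T [ ` i ]
          ⨾ if ` i +ᴺ litᴺ 1 <ᴺ ` m
              then q := T [ ` i +ᴺ litᴺ 1 ]
              else′ q := T [ litᴺ 0 ]
          ⨾ equalizer (` p) (` q)
          ⨾ x*s [ ` i ]:= ` x*
          ⨾ y*s [ ` i ]:= ` y*
          ⨾ top [ ` i ]:= score (` p) ) )
    ⨾ ( for p below ` n ▹ inS [ ` p ]:= inX [ ` p ] )
    ⨾ ( for p below ` n ▹
          when notᴮ (inX [ ` p ]) ▹
            for i below ` m ▹
              when (1ᴿ -ᴿ ` ε) *ᴿ top [ ` i ]
                   ≤ᴿ px [ ` p ] *ᴿ x*s [ ` i ] +ᴿ py [ ` p ] *ᴿ y*s [ ` i ] ▹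
                inS [ ` p ]:= litᴮ true )
    ⨾ collect inS S N
    ⨾ sortByAngle S N

  -- l is the maximum over X[ p , q ], and 0 if that set is empty. If p and q
  -- lie on a common ray from the origin, a point of X on that ray contributes
  -- 1 - 0 * 0 ⁻¹ = 1, whatever 0 ⁻¹ is.
  edgeLoss : Cmd
  edgeLoss =
      equalizer (` p) (` q)
    ⨾ l := 0ᴿ
    ⨾ found := litᴮ false
    ⨾ for r below ` m ▹
        when inRange (` p) (` q) (T [ ` r ]) ▹
          ( val := 1ᴿ -ᴿ score (` p) /ᴿ score (T [ ` r ])
          ⨾ when notᴮ (` found) orᴮ (` l <ᴿ ` val) ▹
              ( l := ` val
              ⨾ found := litᴮ true ) )

  graph : Cmd
  graph =
    for i below ` N ▹
      for j below ` N ▹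
        ( adj [ ` i *ᴺ ` N +ᴺ ` j ]:= litᴮ false
        ⨾ p := S [ ` i ]
        ⨾ q := S [ ` j ]
        ⨾ when notᴮ (` i ≡ᴺ ` j) andᴮ within-π (` p) (` q) ▹
            ( edgeLoss
            ⨾ when ` l ≤ᴿ ` ε ▹ adj [ ` i *ᴺ ` N +ᴺ ` j ]:= litᴮ true ) )

  -- Every edge has length 1. The predecessor of src is src itself.
  dijkstra : Cmd
  dijkstra =
      ( for v below ` N ▹
          ( dist [ ` v ]:= ` inf
          ⨾ pred [ ` v ]:= ` src
          ⨾ done [ ` v ]:= litᴮ false ) )
    ⨾ dist [ ` src ]:= litᴺ 0
    ⨾ for r below ` N ▹
        ( bestDist := ` inf
        ⨾ u := litᴺ 0
        ⨾ ( for v below ` N ▹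
              when notᴮ (done [ ` v ]) andᴮ (dist [ ` v ] <ᴺ ` bestDist) ▹
                ( u := ` v
                ⨾ bestDist := dist [ ` v ] ) )
        ⨾ when ` bestDist <ᴺ ` inf ▹
            ( done [ ` u ]:= litᴮ true
            ⨾ for v below ` N ▹
                when adj [ ` u *ᴺ ` N +ᴺ ` v ]
                     andᴮ (` bestDist +ᴺ litᴺ 1 <ᴺ dist [ ` v ]) ▹
                  ( dist [ ` v ]:= ` bestDist +ᴺ litᴺ 1
                  ⨾ pred [ ` v ]:= ` u ) ) )

  -- A shortest cycle through src is closed by an edge v → src with
  -- dist [ v ] least; it consists of the points on the path from src to v.
  shortestCycle : Cmd
  shortestCycle =
      inf := ` N +ᴺ litᴺ 1
    ⨾ bestLen := ` inf
    ⨾ ( for p below ` n ▹ C [ ` p ]:= litᴮ false )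
    ⨾ for src below ` N ▹
        ( dijkstra
        ⨾ improved := litᴮ false
        ⨾ ( for v below ` N ▹
              when adj [ ` v *ᴺ ` N +ᴺ ` src ]
                   andᴮ (dist [ ` v ] +ᴺ litᴺ 1 <ᴺ ` bestLen) ▹
                ( bestLen := dist [ ` v ] +ᴺ litᴺ 1
                ⨾ end := ` v
                ⨾ improved := litᴮ true ) )
        ⨾ when ` improved ▹
            ( ( for p below ` n ▹ C [ ` p ]:= litᴮ false )
            ⨾ for r below ` N ▹
                ( C [ S [ ` end ] ]:= litᴮ true
                ⨾ end := pred [ ` end ] ) ) )

  E-GRMR : Cmd
  E-GRMR = indexX ⨾ candidates ⨾ graph ⨾ shortestCycle

------------------------------------------------------------------------

module _ (R : Reals) where
  open Reals R
  open Plane R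
  open Machine R

  load : ∀ {n} {A : Set} → A → (Fin n → A) → ℕ → A
  load {n} d f k with k ℕ.<? n
  ... | yes k<n = f (fromℕ< k<n)
  ... | no  _   = d

  blank : State
  blank = mkState (λ { nat _ → 0 ; real _ → 0ℝ ; bool _ → false })
                  (λ { nat _ _ → 0 ; real _ _ → 0ℝ ; bool _ _ → false })

  input : ∀ {n} → (Fin n → Point) → Subset n → ℝ → State
  input {n} P X ε = record s
    { arrs = update {λ σ → ℕ → Val σ} real
               (put (Arr.name Program.px) (load 0ℝ (proj₁ ∘ P)) ∘
                put (Arr.name Program.py) (load 0ℝ (proj₂ ∘ P)))
               (update {λ σ → ℕ → Val σ} bool
                 (put (Arr.name Program.inX) (load false (lookup X)))
                 (arrs s)) }
    where
    s : State
    s = setVar Program.n n (setVar Program.ε ε blank)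

  E-GRMR-time : ∀ {n} → (Fin n → Point) → Subset n → ℝ → ℕ
  E-GRMR-time P X ε = proj₂ (exec Program.E-GRMR (input P X ε))

{-# OPTIONS --safe #-}
module Submission where

-- E-GRMR consists of nested counting loops whose bounds are n, m = |X| and
-- N = |S|. Filling T and S increments m and N at most once for each of the n
-- points and nothing else writes to these variables, so every loop makes at
-- most n iterations. A command whose loops are nested at most d deep then runs
-- in time O(n ^ d), and the loops of E-GRMR are nested three deep.

open import Defs
open import Data.Bool.Base using (true; false; T)
open import Data.Empty using (⊥)
open import Data.Fin.Base using (Fin)
open import Data.Fin.Subset using (Subset)
open import Data.Nat.Base as ℕ using (ℕ; zero; suc; NonZero; z≤n; s≤s)
open import Data.Nat.Properties
open import Data.Nat.Tactic.RingSolver using (solve-∀)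
open import Data.Product.Base using (_×_; _,_; proj₁; proj₂; ∃-syntax)
open import Data.Unit.Base using (⊤)
open import Function.Base using (const)
open import Function.Definitions using (Injective)
open import Relation.Binary.PropositionalEquality using (_≡_; refl; sym; subst)

depth : Cmd → ℕ
depth skip                  = 0
depth (_ := _)              = 0
depth (_ [ _ ]:= _)         = 0
depth (c ⨾ d)               = depth c ℕ.⊔ depth d
depth (if _ then c else′ d) = depth c ℕ.⊔ depth d
depth (for _ below _ ▹ c)   = suc (depth c)

-- The names below 3 are those of n, m and N.
IsSize : ℕ → Set
IsSize x = T (x ℕ.<ᵇ 3)

SizeBound : Exp nat → Set
SizeBound (` (mkVar x)) = IsSize x
SizeBound (e ∸ᴺ _)      = SizeBound e
SizeBound _             = ⊥

-- Variables of different types are stored separately, so a real or boolean variable may share its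
-- name with a size.
KeepsSizes : ∀ {τ} → Var τ → Set
KeepsSizes {nat}  (mkVar x) = T (2 ℕ.<ᵇ x)
KeepsSizes {real} _         = ⊤
KeepsSizes {bool} _         = ⊤

-- The condition is purely syntactic: for a concrete tame command it computes to a product of unit
-- types. It fails for `collect`, which assigns to its size variable.
Tame : Cmd → Set
Tame skip                  = ⊤
Tame (x := _)              = KeepsSizes x
Tame (_ [ _ ]:= _)         = ⊤
Tame (c ⨾ d)               = Tame c × Tame d
Tame (if _ then c else′ d) = Tame c × Tame d
Tame (for x below e ▹ c)   = KeepsSizes x × SizeBound e × Tame c

module _ (R : Reals) where
  open Machine R

  -- Adding both branches of a conditional avoids a case distinction on the test. For a loop, the
  -- summands pay for the entry, for the first loop test, and for one iteration of the body with the
  -- test after it.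
  coeff : Cmd → ℕ
  coeff skip                  = 1
  coeff (_ := e)              = 1 ℕ.+ expTime e
  coeff (_ [ i ]:= e)         = 1 ℕ.+ expTime i ℕ.+ expTime e
  coeff (c ⨾ d)               = coeff c ℕ.+ coeff d
  coeff (if b then c else′ d) = (1 ℕ.+ expTime b) ℕ.+ (coeff c ℕ.+ coeff d)
  coeff (for _ below e ▹ c)   = (1 ℕ.+ expTime e) ℕ.+ (1 ℕ.+ (coeff c ℕ.+ 1))

  put-same : ∀ {A : Set} x (a : A) f → put x a f x ≡ a
  put-same zero    a f = refl
  put-same (suc x) a f = put-same x a (λ y → f (suc y))

  put-mono : ∀ x y {a b f g} → a ℕ.≤ b → f y ℕ.≤ g y → put x a f y ℕ.≤ put x b g y
  put-mono x y a≤b fy≤gy with x ℕ.≡ᵇ y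
  ... | true  = a≤b
  ... | false = fy≤gy

  -- B is the number of points.
  module _ (B : ℕ) .{{_ : NonZero B}} where

    m≤m*B^d : ∀ k d → k ℕ.≤ k ℕ.* B ℕ.^ d
    m≤m*B^d k d = m≤m*n k (B ℕ.^ d) {{m^n≢0 B d}}

    raise-degree : ∀ k {d e} → d ℕ.≤ e → k ℕ.* B ℕ.^ d ℕ.≤ k ℕ.* B ℕ.^ e
    raise-degree k d≤e = *-monoʳ-≤ k (^-monoʳ-≤ B d≤e)

    raiseˡ : ∀ k d e → k ℕ.* B ℕ.^ d ℕ.≤ k ℕ.* B ℕ.^ (d ℕ.⊔ e)
    raiseˡ k d e = raise-degree k (m≤m⊔n d e)

    raiseʳ : ∀ k d e → k ℕ.* B ℕ.^ e ℕ.≤ k ℕ.* B ℕ.^ (d ℕ.⊔ e)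
    raiseʳ k d e = raise-degree k (m≤n⊔m d e)

    sum-bound : ∀ k l d {s t} → s ℕ.≤ k ℕ.* B ℕ.^ d → t ℕ.≤ l ℕ.* B ℕ.^ d →
                s ℕ.+ t ℕ.≤ (k ℕ.+ l) ℕ.* B ℕ.^ d
    sum-bound k l d s≤ t≤ =
      ≤-trans (+-mono-≤ s≤ t≤) (≤-reflexive (sym (*-distribʳ-+ (B ℕ.^ d) k l)))

    -- The inner 1 is the loop test of an iteration, absorbed because `B ^ d` is at least 1. The
    -- number of iterations contributes the extra factor `B`.
    iterations-bound : ∀ k d {b} → b ℕ.≤ B →
      b ℕ.* (k ℕ.* B ℕ.^ d ℕ.+ 1) ℕ.≤ (k ℕ.+ 1) ℕ.* B ℕ.^ suc d
    iterations-bound k d {b} b≤B = begin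
      b ℕ.* (k ℕ.* B ℕ.^ d ℕ.+ 1)
        ≤⟨ *-mono-≤ b≤B (sum-bound k 1 d ≤-refl (m≤m*B^d 1 d)) ⟩
      B ℕ.* ((k ℕ.+ 1) ℕ.* B ℕ.^ d)
        ≡⟨ exchange B (k ℕ.+ 1) (B ℕ.^ d) ⟩
      (k ℕ.+ 1) ℕ.* B ℕ.^ suc d ∎
      where
      open ≤-Reasoning
      exchange : ∀ x y z → x ℕ.* (y ℕ.* z) ≡ y ℕ.* (x ℕ.* z)
      exchange = solve-∀

    -- A Hoare triple that also bounds the running time. As a record type it lets unification
    -- recover `P`, `c` and `Q`.
    record ⟪_⟫_⟪_⟫ (P : State → Set) (c : Cmd) (Q : State → Set) : Set where
      constructor rule
      field
        run : ∀ s → P s → Q (proj₁ (exec c s)) ×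
                          proj₂ (exec c s) ℕ.≤ coeff c ℕ.* B ℕ.^ depth c
    open ⟪_⟫_⟪_⟫

    weaken-pre : ∀ {P P′ Q c} → (∀ s → P′ s → P s) → ⟪ P ⟫ c ⟪ Q ⟫ → ⟪ P′ ⟫ c ⟪ Q ⟫
    weaken-pre P′⇒P H = rule λ s P′s → run H s (P′⇒P s P′s)

    skip-rule : ∀ {P Q} → (∀ s → P s → Q s) → ⟪ P ⟫ skip ⟪ Q ⟫
    skip-rule P⇒Q = rule λ s Ps → P⇒Q s Ps , ≤-refl

    assign-rule : ∀ {P Q τ} {x : Var τ} {e} →
                  (∀ s → P s → Q (setVar x (eval e s) s)) → ⟪ P ⟫ x := e ⟪ Q ⟫
    assign-rule P⇒Q = rule λ s Ps → P⇒Q s Ps , m≤m*B^d _ 0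

    store-rule : ∀ {P Q τ} {a : Arr τ} {i e} →
                 (∀ s → P s → Q (setArr a (eval i s) (eval e s) s)) →
                 ⟪ P ⟫ a [ i ]:= e ⟪ Q ⟫
    store-rule P⇒Q = rule λ s Ps → P⇒Q s Ps , m≤m*B^d _ 0

    infixr 2 _⨾-rule_
    _⨾-rule_ : ∀ {P Q U c d} → ⟪ P ⟫ c ⟪ Q ⟫ → ⟪ Q ⟫ d ⟪ U ⟫ → ⟪ P ⟫ c ⨾ d ⟪ U ⟫
    _⨾-rule_ {c = c} {d} Hc Hd = rule λ s Ps →
      let Qs₁ , t₁≤ = run Hc s Ps
          Us₂ , t₂≤ = run Hd _ Qs₁
      in Us₂ , sum-bound (coeff c) (coeff d) (depth c ℕ.⊔ depth d)
                 (≤-trans t₁≤ (raiseˡ (coeff c) (depth c) (depth d)))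
                 (≤-trans t₂≤ (raiseʳ (coeff d) (depth c) (depth d)))

    if-rule : ∀ {P Q b c d} → ⟪ P ⟫ c ⟪ Q ⟫ → ⟪ P ⟫ d ⟪ Q ⟫ →
              ⟪ P ⟫ if b then c else′ d ⟪ Q ⟫
    if-rule {P} {Q} {b} {c} {d} Hc Hd = rule go
      where
      e : ℕ
      e = depth c ℕ.⊔ depth d

      add-test : ∀ {t} → t ℕ.≤ (coeff c ℕ.+ coeff d) ℕ.* B ℕ.^ e →
                 (1 ℕ.+ expTime b) ℕ.+ t ℕ.≤ coeff (if b then c else′ d) ℕ.* B ℕ.^ e
      add-test = sum-bound (1 ℕ.+ expTime b) (coeff c ℕ.+ coeff d) e (m≤m*B^d _ e)

      go : ∀ s → P s →
           Q (proj₁ (exec (if b then c else′ d) s)) ×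
           proj₂ (exec (if b then c else′ d) s) ℕ.≤ coeff (if b then c else′ d) ℕ.* B ℕ.^ e
      go s Ps with eval b s
      ... | true  =
        let Qs , t≤ = run Hc s Ps in
        Qs , add-test (≤-trans t≤ (≤-trans (raiseˡ (coeff c) (depth c) (depth d))
               (*-monoˡ-≤ (B ℕ.^ e) (m≤m+n (coeff c) (coeff d)))))
      ... | false =
        let Qs , t≤ = run Hd s Ps in
        Qs , add-test (≤-trans t≤ (≤-trans (raiseʳ (coeff d) (depth c) (depth d))
               (*-monoˡ-≤ (B ℕ.^ e) (m≤n+m (coeff d) (coeff c)))))

    repeat-bound : (J : ℕ → State → Set) (f : ℕ → Run) (K : ℕ) →
      (∀ k s → J k s → J (suc k) (proj₁ (f k s)) × proj₂ (f k s) ℕ.≤ K) →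
      ∀ k s → J 0 s →
      J k (proj₁ (repeat f k s)) ×
      proj₂ (repeat f k s) ℕ.≤ 1 ℕ.+ k ℕ.* (K ℕ.+ 1)
    repeat-bound J f K step zero    s J₀ = J₀ , ≤-refl
    repeat-bound J f K step (suc k) s J₀ =
      let Jk , t₁≤ = repeat-bound J f K step k s J₀
          Jk+1 , t₂≤ = step k _ Jk
      in Jk+1 , ≤-trans (+-mono-≤ t₁≤ (+-monoˡ-≤ 1 t₂≤))
                  (≤-reflexive (rearrange (k ℕ.* (K ℕ.+ 1)) (K ℕ.+ 1)))
      where
      rearrange : ∀ x y → 1 ℕ.+ x ℕ.+ y ≡ 1 ℕ.+ (y ℕ.+ x)
      rearrange = solve-∀

    -- `J k` is the invariant after `k` iterations. Since `e` is evaluated once, on entry, it has to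
    -- be bounded only under `P`; its value is the final `k`, whence the `k ≤ B` available for
    -- deriving `Q`.
    for-rule : ∀ {P Q x e c} (J : ℕ → State → Set) →
      (∀ s → P s → eval e s ℕ.≤ B) →
      (∀ s → P s → J 0 s) →
      (∀ k s → J k s → J k (setVar x k s)) →
      (∀ k → ⟪ J k ⟫ c ⟪ J (suc k) ⟫) →
      (∀ k s → k ℕ.≤ B → J k s → Q s) →
      ⟪ P ⟫ for x below e ▹ c ⟪ Q ⟫
    for-rule {x = x} {e} {c} J bound init keep step final = rule λ s Ps →
      let Jk , t≤ = repeat-bound J (λ k s′ → exec c (setVar x k s′))
                      (coeff c ℕ.* B ℕ.^ depth c)
                      (λ k s′ Js′ → run (step k) _ (keep k s′ Js′))
                      (eval e s) s (init s Ps)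
          d = suc (depth c)
      in final _ _ (bound s Ps) Jk ,
         sum-bound (1 ℕ.+ expTime e) (1 ℕ.+ (coeff c ℕ.+ 1)) d (m≤m*B^d _ d)
           (≤-trans t≤ (sum-bound 1 (coeff c ℕ.+ 1) d (m≤m*B^d 1 d)
             (iterations-bound (coeff c) (depth c) (bound s Ps))))

    SizesBelow : (ℕ → ℕ) → State → Set
    SizesBelow b s = ∀ y → IsSize y → vars s nat y ℕ.≤ b y

    Sizes : State → Set
    Sizes = SizesBelow (const B)

    setVar-keeps : ∀ {b τ} (x : Var τ) {v} s → KeepsSizes x →
                   SizesBelow b s → SizesBelow b (setVar x v s)
    setVar-keeps {τ = nat}  (mkVar (suc (suc (suc x)))) s _ H 0 = H 0
    setVar-keeps {τ = nat}  (mkVar (suc (suc (suc x)))) s _ H 1 = H 1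
    setVar-keeps {τ = nat}  (mkVar (suc (suc (suc x)))) s _ H 2 = H 2
    setVar-keeps {τ = real} x s _ H = H
    setVar-keeps {τ = bool} x s _ H = H

    sizeBound-bound : ∀ e → SizeBound e → ∀ s → Sizes s → eval e s ℕ.≤ B
    sizeBound-bound (` (mkVar x)) h s H = H x h
    sizeBound-bound (e ∸ᴺ f)      h s H =
      ≤-trans (m∸n≤m (eval e s) (eval f s)) (sizeBound-bound e h s H)

    tame-rule : ∀ c → Tame c → ⟪ Sizes ⟫ c ⟪ Sizes ⟫
    tame-rule skip                  _         = skip-rule (λ _ H → H)
    tame-rule (x := e)              h         = assign-rule (λ s → setVar-keeps x s h)
    tame-rule (a [ i ]:= e)         _         = store-rule (λ _ H → H)
    tame-rule (c ⨾ d)               (hc , hd) = tame-rule c hc ⨾-rule tame-rule d hd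
    tame-rule (if b then c else′ d) (hc , hd) = if-rule (tame-rule c hc) (tame-rule d hd)
    tame-rule (for x below e ▹ c)   (hx , he , hc) =
      for-rule (const Sizes) (sizeBound-bound e he) (λ _ H → H)
        (λ _ s → setVar-keeps x s hx) (λ _ → tame-rule c hc) (λ _ _ _ H → H)

    -- The loop invariant of `collect`: once `k` points have been scanned, at most `k` have been
    -- stored, while the other sizes are still bounded by `B`.
    SizeUpTo : ℕ → ℕ → State → Set
    SizeUpTo x k = SizesBelow (put x k (const B))

    reset-size : ∀ x s → Sizes s → SizeUpTo x 0 (setVar {nat} (mkVar x) 0 s)
    reset-size x s H y hy = put-mono x y {f = vars s nat} z≤n (H y hy)

    increment-size : ∀ x k s → IsSize x → SizeUpTo x k s →
                     SizeUpTo x (suc k) (setVar {nat} (mkVar x) (vars s nat x ℕ.+ 1) s)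
    increment-size x k s hx H y hy with x ℕ.≡ᵇ y | H y hy
    ... | false | le = le
    ... | true  | _  =
      subst (ℕ._≤ suc k) (+-comm 1 (vars s nat x))
        (s≤s (subst (vars s nat x ℕ.≤_) (put-same x k (const B)) (H x hx)))

    SizeUpTo-suc : ∀ x k s → SizeUpTo x k s → SizeUpTo x (suc k) s
    SizeUpTo-suc x k s H y hy =
      ≤-trans (H y hy) (put-mono x y {f = const B} (n≤1+n k) ≤-refl)

    SizeUpTo⇒Sizes : ∀ x k s → k ℕ.≤ B → SizeUpTo x k s → Sizes s
    SizeUpTo⇒Sizes x k s k≤B H y hy with x ℕ.≡ᵇ y | H y hy
    ... | true  | le = ≤-trans le k≤B
    ... | false | le = le

    collect-rule : ∀ marks A x → IsSize x →
                   ⟪ Sizes ⟫ Program.collect marks A (mkVar x) ⟪ Sizes ⟫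
    collect-rule marks A x hx =
      assign-rule (reset-size x) ⨾-rule
      for-rule (SizeUpTo x)
        -- The loop bound is the variable `n`, whose name is 0.
        (λ s H → SizeUpTo⇒Sizes x 0 s z≤n H 0 _)
        (λ _ H → H)
        (λ _ s → setVar-keeps Program.p s _)
        (λ k → if-rule
          -- Storing the point changes only an array; the invariant advances to `suc k` with the
          -- increment. For an unmarked point it advances by weakening.
          (store-rule {Q = SizeUpTo x k} (λ _ H → H) ⨾-rule
           assign-rule (λ s → increment-size x k s hx))
          (skip-rule (SizeUpTo-suc x k)))
        (SizeUpTo⇒Sizes x)

    -- Only the two calls of `collect` write to a size; all the rest is tame. The side conditions
    -- are unit types here and are filled in by eta.
    E-GRMR-rule : ⟪ Sizes ⟫ Program.E-GRMR ⟪ Sizes ⟫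
    E-GRMR-rule =
      (collect-rule _ _ _ _ ⨾-rule tame-rule _ _) ⨾-rule
      (tame-rule _ _ ⨾-rule tame-rule _ _ ⨾-rule tame-rule _ _ ⨾-rule
       collect-rule _ _ _ _ ⨾-rule tame-rule _ _) ⨾-rule
      tame-rule _ _ ⨾-rule
      tame-rule _ _

theorem3 : ∃[ c ] ∃[ n₀ ]
    ((R : Reals) → let open Reals R in let open Plane R in
    (n : ℕ) .{{_ : NonZero n}} → n₀ ℕ.≤ n →
    (P : Fin n → Point) → Injective _≡_ _≡_ P → StandingCondition P →
    (X : Subset n) → IsExtremeSet P X →
    (ε : ℝ) → 0ℝ < ε → ε < 1ℝ →
    E-GRMR-time R P X ε ℕ.≤ c ℕ.* n ℕ.^ 3)
-- 837 is the value of coeff R E-GRMR, which does not depend on R.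
theorem3 = 837 , 0 , λ R n _ P _ _ X _ ε _ _ →
  proj₂ (⟪_⟫_⟪_⟫.run (E-GRMR-rule R n) (input R P X ε)
    -- In the input state the variable `n` holds the number of points, and `m` and `N` still hold
    -- the blank value 0.
    λ { 0 _ → ≤-refl ; 1 _ → z≤n ; 2 _ → z≤n })
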